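{- Let $\mathcal{D}=(X,\mathcal{B})$ be a $(v,k,\lambda)$ symmetric design of order $q=k-\lambda\geq 2$. Then there exists a semi-resolving set for the points of $\mathcal{D}$ of size $\left\lceil \frac{v\log v}{k-\lambda}\right\rceil$, i.e. a set $S_\mathcal{B}\subseteq\mathcal{B}$ of this size such that for every pair of distinct points $x,y\in X$ some block $B\in S_\mathcal{B}$ satisfies $d(x,B)\neq d(y,B)$ in the incidence graph of $\mathcal{D}$ (equivalently, $B$ contains exactly one of $x,y$).
   Context: A symmetric design with parameters $(v,k,\lambda)$ is a pair $(X,\mathcal{B})$ where $X$ is a set of $v$ points and $\mathcal{B}$ is a family of $k$-subsets of $X$ (blocks) such that any two distinct points lie in exactly $\lambda$ blocks and any two distinct blocks meet in exactly $\lambda$ points. Its order is $q=k-\lambda$. The incidence graph is the bipartite graph on $X\cup\mathcal{B}$ with $x$ adjacent to $B$ iff $x\in B$; $d$ is graph distance. $\log$ denotes the natural logarithm. -}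

module Defs where

import Algebra.Definitions.RawSemiring
open import Data.Fin.Base using (Fin)
open import Data.Fin.Subset using (Subset; _∈_; _∩_; ∣_∣)
open import Data.Integer.Base using (+_)
open import Data.Nat.Base as ℕ using (ℕ; zero; suc; NonZero; _!)
open import Data.Nat.Properties using (_!≢0)
open import Data.Product.Base using (_×_; ∃; ∃₂)
open import Data.Rational.Base as ℚ using (ℚ; 0ℚ; 1ℚ; _/_; +-*-rawSemiring)
open import Data.Sum.Base using (_⊎_; inj₁; inj₂)
open import Data.Vec.Base using (lookup; tabulate)
open import Function.Definitions using (Injective)
open import Relation.Binary.PropositionalEquality using (_≡_; _≢_)
open import Relation.Nullary.Negation using (¬_)

open Algebra.Definitions.RawSemiring +-*-rawSemiring using (_^_)

-- Points and blocks are both indexed by Fin v: a symmetric design has as many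
-- blocks as points.  Building this in excludes only the degenerate pairs with
-- at most one block (such as the single block X, with k = v and λ = 1), which
-- satisfy the two intersection conditions but are not symmetric designs.

record SymmetricDesign (v k l : ℕ) : Set where
  field
    block           : Fin v → Subset v
    block-injective : Injective _≡_ _≡_ block

  blocksThrough : Fin v → Subset v
  blocksThrough x = tabulate (λ B → lookup (block B) x)

  field
    block-size  : ∀ B → ∣ block B ∣ ≡ k
    points-join : ∀ {x y} → x ≢ y → ∣ blocksThrough x ∩ blocksThrough y ∣ ≡ l
    blocks-meet : ∀ {B C} → B ≢ C → ∣ block B ∩ block C ∣ ≡ l

data Walk {V : Set} (_~_ : V → V → Set) : ℕ → V → V → Set where
  []  : ∀ {u} → Walk _~_ 0 u u
  _∷_ : ∀ {n u w z} → u ~ w → Walk _~_ n w z → Walk _~_ (suc n) u z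

IsDistance : {V : Set} (_~_ : V → V → Set) → V → V → ℕ → Set
IsDistance _~_ u w n = Walk _~_ n u w × (∀ m → Walk _~_ m u w → n ℕ.≤ m)

module _ {v k l : ℕ} (D : SymmetricDesign v k l) where
  open SymmetricDesign D

  Vertex : Set
  Vertex = Fin v ⊎ Fin v

  point : Fin v → Vertex
  point = inj₁

  blockVertex : Fin v → Vertex
  blockVertex = inj₂

  data Adjacent : Vertex → Vertex → Set where
    point-block : ∀ {x B} → x ∈ block B → Adjacent (point x) (blockVertex B)
    block-point : ∀ {x B} → x ∈ block B → Adjacent (blockVertex B) (point x)

  -- d(x,B) ≠ d(y,B), both distances being finite.
  Resolves : Fin v → Fin v → Fin v → Set
  Resolves B x y = ∃₂ λ m n →
    IsDistance Adjacent (point x) (blockVertex B) m ×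
    IsDistance Adjacent (point y) (blockVertex B) n ×
    m ≢ n

  SemiResolvingForPoints : Subset v → Set
  SemiResolvingForPoints S =
    ∀ {x y} → x ≢ y → ∃ λ B → B ∈ S × Resolves B x y

fromℕ : ℕ → ℚ
fromℕ n = + n / 1

-- Σ_{i < m} rⁱ / i!, so that exp r is the limit of expSum r m as m → ∞.
expSum : ℚ → ℕ → ℚ
expSum r zero    = 0ℚ
expSum r (suc m) = expSum r m ℚ.+ (r ^ m) ℚ.* (_/_ (+ 1) (m !) {{m !≢0}})

-- The order of Cauchy reals: lim a < c.
Limit_<_ : (ℕ → ℚ) → ℚ → Set
Limit a < c = ∃₂ λ ε N → 0ℚ ℚ.< ε × (∀ m → N ℕ.≤ m → a m ℚ.+ ε ℚ.≤ c)

-- A real number is given by its (open) lower Dedekind cut: x r means r < x,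
-- and so ¬ x r means x ≤ r.
LowerCut : Set₁
LowerCut = ℚ → Set

-- The natural logarithm as the inverse of exp: r < log n iff exp r < n.
log : (n : ℕ) .{{_ : NonZero n}} → LowerCut
log n r = Limit (expSum r) < fromℕ n

infixr 7 _·_
infixl 6 _÷_

-- r < n x iff r / n < x.
_·_ : (n : ℕ) .{{_ : NonZero n}} → LowerCut → LowerCut
(n · x) r = x (r ℚ.* (+ 1 / n))

-- r < x / n iff r n < x.
_÷_ : LowerCut → (n : ℕ) .{{_ : NonZero n}} → LowerCut
(x ÷ n) r = x (r ℚ.* fromℕ n)

-- n = ⌈ x ⌉ iff n - 1 < x ≤ n.
IsCeiling : ℕ → LowerCut → Set
IsCeiling n x = x (fromℕ n ℚ.- 1ℚ) × ¬ x (fromℕ n)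

2≤⇒nonZero : ∀ {n} → 2 ℕ.≤ n → NonZero n
2≤⇒nonZero (ℕ.s≤s _) = _

{-# OPTIONS --safe #-}

-- Counting flags shows that every point lies on k blocks and that k (k - 1) = λ (v - 1); hence
-- two distinct points are separated by exactly 2q blocks, and v ≤ q² + q + 1.  Choosing blocks
-- greedily, each one separates at least the average proportion 2q / v of the pairs that are still
-- unseparated, so after n steps at most v (v - 1) (1 - 2q/v)ⁿ < v² (1 - q/v)²ⁿ ≤ 1 ordered pairs
-- are left, because v ≤ exp (nq/v) ≤ (1 - q/v)⁻ⁿ for n = ⌈v log v / q⌉.  A block
-- separating x and y is at distance 1 from one of them and 3 from the other.  The bound on v
-- gives v ≤ exp q, so that n ≤ v and there are enough blocks to reach size exactly n.

module Submission where

open import Defs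
import Algebra.Definitions.RawSemiring
import Algebra.Properties.Semiring.Sum
open import Data.Bool.Base using (Bool; true; false; not; _∧_; _xor_; if_then_else_)
open import Data.Fin.Base using (Fin; zero; suc; punchIn; combine; remQuot)
import Data.Fin.Properties as Fin
open import Data.Fin.Subset using (Subset; inside; outside; _∈_; _⊆_; _∩_; _∪_; ⊤; ⊥; ⁅_⁆; ∣_∣; Nonempty)
open import Data.Fin.Subset.Properties using (∣⊤∣≡n; ∣⊥∣≡0; ∣⁅x⁆∣≡1; ∈⊤; x∈⁅x⁆; p⊆p∪q; q⊆p∪q; nonempty?; Empty-unique; x∈p∩q⁻)
import Data.Integer.Base as ℤ
import Data.Integer.Properties as ℤ
open import Data.Nat.Base as ℕ using (ℕ; zero; suc; NonZero; _+_; _*_; _∸_; _≤_; _<_; z≤n; s≤s; _!; ≢-nonZero⁻¹; >-nonZero)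
import Data.Nat.Properties as ℕ
import Data.Nat.Solver as ℕSolver
open import Data.Product.Base using (_×_; _,_; ∃; proj₁; proj₂; uncurry)
open import Data.Rational.Base as ℚ using (ℚ; 0ℚ; 1ℚ; _/_; NonNegative; +-*-rawSemiring)
import Data.Rational.Properties as ℚ
import Data.Rational.Solver as ℚSolver
import Data.Rational.Unnormalised.Base as ℚᵘ
import Data.Rational.Unnormalised.Properties as ℚᵘ
open import Data.Sum.Base using (_⊎_; inj₁; inj₂)
open import Data.Vec.Base using ([]; _∷_; here; there; lookup)
open import Data.Vec.Properties using (lookup-zipWith; lookup∘tabulate; lookup⇒[]=; []=⇒lookup)
open import Function.Base using (_∘_)
open import Relation.Binary.PropositionalEquality using (_≡_; _≢_; refl; sym; trans; cong; cong₂; subst; module ≡-Reasoning)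
open import Relation.Nullary using (¬_; yes; no; contradiction; ⌊_⌋)

-- Bounds on the exponential series

module _ where
  open Algebra.Definitions.RawSemiring +-*-rawSemiring using (_^_)
  open import Data.Integer.Base using (+_)
  open import Data.Nat.Properties using (_!≢0)
  open ℚSolver.+-*-Solver using (solve; _:=_; _:+_; _:*_; :-_; con)

  -- Natural numbers and their reciprocals in the rationals.

  fromℕ-+ : ∀ m n → fromℕ (m ℕ.+ n) ≡ fromℕ m ℚ.+ fromℕ n
  -- Addition in `ℚ` normalises its result, so the identity is checked on unnormalised fractions
  -- with denominator 1.
  fromℕ-+ m n = ℚ.toℚᵘ-injective (begin
    ℚ.toℚᵘ (fromℕ (m ℕ.+ n))                  ≈⟨ ℚ.toℚᵘ-fromℚᵘ (unnorm (m ℕ.+ n)) ⟩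
    unnorm (m ℕ.+ n)                          ≈⟨ ℚᵘ.*≡* (cong (ℤ._* + 1) (cong₂ ℤ._+_ (sym (ℤ.*-identityʳ (+ m))) (sym (ℤ.*-identityʳ (+ n))))) ⟩
    unnorm m ℚᵘ.+ unnorm n                    ≈⟨ ℚᵘ.+-cong (ℚ.toℚᵘ-fromℚᵘ (unnorm m)) (ℚ.toℚᵘ-fromℚᵘ (unnorm n)) ⟨
    ℚ.toℚᵘ (fromℕ m) ℚᵘ.+ ℚ.toℚᵘ (fromℕ n)    ≈⟨ ℚ.toℚᵘ-homo-+ (fromℕ m) (fromℕ n) ⟨
    ℚ.toℚᵘ (fromℕ m ℚ.+ fromℕ n)              ∎)
    where
    open ℚᵘ.≃-Reasoning
    unnorm : ℕ → ℚᵘ.ℚᵘ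
    unnorm i = ℚᵘ.mkℚᵘ (+ i) 0

  fromℕ-* : ∀ m n → fromℕ (m ℕ.* n) ≡ fromℕ m ℚ.* fromℕ n
  fromℕ-* zero    n = sym (ℚ.*-zeroˡ (fromℕ n))
  fromℕ-* (suc m) n = begin
    fromℕ (n ℕ.+ m ℕ.* n)                  ≡⟨ fromℕ-+ n (m ℕ.* n) ⟩
    fromℕ n ℚ.+ fromℕ (m ℕ.* n)            ≡⟨ cong (fromℕ n ℚ.+_) (fromℕ-* m n) ⟩
    fromℕ n ℚ.+ fromℕ m ℚ.* fromℕ n        ≡⟨ solve 2 (λ m n → n :+ m :* n := (con 1ℚ :+ m) :* n) refl (fromℕ m) (fromℕ n) ⟩
    (1ℚ ℚ.+ fromℕ m) ℚ.* fromℕ n           ≡⟨ cong (ℚ._* fromℕ n) (fromℕ-+ 1 m) ⟨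
    fromℕ (suc m) ℚ.* fromℕ n              ∎
    where open ≡-Reasoning

  fromℕ-nonNeg : ∀ n → NonNegative (fromℕ n)
  fromℕ-nonNeg n = ℚ.normalize-nonNeg n 1

  fromℕ-mono-≤ : ∀ {m n} → m ℕ.≤ n → fromℕ m ℚ.≤ fromℕ n
  fromℕ-mono-≤ {m} {n} m≤n = begin
    fromℕ m                          ≡⟨ ℚ.+-identityʳ (fromℕ m) ⟨
    fromℕ m ℚ.+ 0ℚ                   ≤⟨ ℚ.+-monoʳ-≤ (fromℕ m) (ℚ.nonNegative⁻¹ _ {{fromℕ-nonNeg (n ℕ.∸ m)}}) ⟩
    fromℕ m ℚ.+ fromℕ (n ℕ.∸ m)      ≡⟨ fromℕ-+ m (n ℕ.∸ m) ⟨
    fromℕ (m ℕ.+ (n ℕ.∸ m))          ≡⟨ cong fromℕ (ℕ.m+[n∸m]≡n m≤n) ⟩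
    fromℕ n                          ∎
    where open ℚ.≤-Reasoning

  fromℕ*1/n≡1 : ∀ n .{{_ : NonZero n}} → fromℕ n ℚ.* (+ 1 / n) ≡ 1ℚ
  fromℕ*1/n≡1 (suc d) = ℚ.toℚᵘ-injective (begin
    ℚ.toℚᵘ (fromℕ (suc d) ℚ.* (+ 1 / suc d))              ≈⟨ ℚ.toℚᵘ-homo-* (fromℕ (suc d)) (+ 1 / suc d) ⟩
    ℚ.toℚᵘ (fromℕ (suc d)) ℚᵘ.* ℚ.toℚᵘ (+ 1 / suc d)      ≈⟨ ℚᵘ.*-cong (ℚ.toℚᵘ-fromℚᵘ (ℚᵘ.mkℚᵘ (+ suc d) 0)) (ℚ.toℚᵘ-fromℚᵘ (ℚᵘ.mkℚᵘ (+ 1) d)) ⟩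
    ℚᵘ.mkℚᵘ (+ suc d) 0 ℚᵘ.* ℚᵘ.mkℚᵘ (+ 1) d              ≈⟨ ℚᵘ.*≡* (trans (ℤ.*-identityʳ _) (trans (ℤ.*-comm (+ suc d) (+ 1)) (cong (λ i → + 1 ℤ.* (+ i)) (sym (ℕ.+-identityʳ (suc d)))))) ⟩
    ℚᵘ.1ℚᵘ                                                ∎)
    where open ℚᵘ.≃-Reasoning

  ≤-addʳ : ∀ p {q} → 0ℚ ℚ.≤ q → p ℚ.≤ p ℚ.+ q
  ≤-addʳ p {q} 0≤q = ℚ.≤-trans (ℚ.≤-reflexive (sym (ℚ.+-identityʳ p))) (ℚ.+-monoʳ-≤ p 0≤q)

  0≤* : ∀ {p q} → 0ℚ ℚ.≤ p → 0ℚ ℚ.≤ q → 0ℚ ℚ.≤ p ℚ.* q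
  0≤* {p} {q} 0≤p 0≤q =
    ℚ.nonNegative⁻¹ _ {{ℚ.nonNeg*nonNeg⇒nonNeg p {{ℚ.nonNegative 0≤p}} q {{ℚ.nonNegative 0≤q}}}}

  *-monoˡ-≤ : ∀ {r p q} → 0ℚ ℚ.≤ r → p ℚ.≤ q → r ℚ.* p ℚ.≤ r ℚ.* q
  *-monoˡ-≤ {r} 0≤r = ℚ.*-monoˡ-≤-nonNeg r {{ℚ.nonNegative 0≤r}}

  *-monoʳ-≤ : ∀ {r p q} → 0ℚ ℚ.≤ r → p ℚ.≤ q → p ℚ.* r ℚ.≤ q ℚ.* r
  *-monoʳ-≤ {r} 0≤r = ℚ.*-monoʳ-≤-nonNeg r {{ℚ.nonNegative 0≤r}}

  0≤^ : ∀ {p} → 0ℚ ℚ.≤ p → ∀ i → 0ℚ ℚ.≤ p ^ i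
  0≤^ 0≤p zero    = ℚ.nonNegative⁻¹ 1ℚ
  0≤^ 0≤p (suc i) = 0≤* 0≤p (0≤^ 0≤p i)

  0≤fromℕ : ∀ n → 0ℚ ℚ.≤ fromℕ n
  0≤fromℕ n = ℚ.nonNegative⁻¹ _ {{fromℕ-nonNeg n}}

  0≤1/ : ∀ n .{{_ : NonZero n}} → 0ℚ ℚ.≤ + 1 / n
  0≤1/ n = ℚ.nonNegative⁻¹ _ {{ℚ.normalize-nonNeg 1 n}}

  -- Factorials, powers and partial sums of the exponential series.

  1/_! : ℕ → ℚ
  1/ m ! = _/_ (+ 1) (m !) {{m !≢0}}

  0≤1/! : ∀ m → 0ℚ ℚ.≤ 1/ m !
  0≤1/! m = 0≤1/ (m !) {{m !≢0}}

  -- Expresses that the derivative of the term of degree `suc m` in the exponential series is the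
  -- term of degree `m`.
  1/[1+m]! : ∀ m → fromℕ (suc m) ℚ.* 1/ suc m ! ≡ 1/ m !
  1/[1+m]! m = begin
    s ℚ.* g                       ≡⟨ ℚ.*-identityʳ _ ⟨
    s ℚ.* g ℚ.* 1ℚ                ≡⟨ cong (s ℚ.* g ℚ.*_) (fromℕ*1/n≡1 (m !) {{m !≢0}}) ⟨
    s ℚ.* g ℚ.* (f ℚ.* h)         ≡⟨ solve 4 (λ s g f h → s :* g :* (f :* h) := s :* f :* g :* h) refl s g f h ⟩
    s ℚ.* f ℚ.* g ℚ.* h           ≡⟨ cong (λ z → z ℚ.* g ℚ.* h) (fromℕ-* (suc m) (m !)) ⟨
    fromℕ (suc m !) ℚ.* g ℚ.* h   ≡⟨ cong (ℚ._* h) (fromℕ*1/n≡1 (suc m !) {{suc m !≢0}}) ⟩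
    1ℚ ℚ.* h                      ≡⟨ ℚ.*-identityˡ h ⟩
    h                             ∎
    where
    open ≡-Reasoning
    s = fromℕ (suc m)
    f = fromℕ (m !)
    g = 1/ suc m !
    h = 1/ m !

  ^-mono-≤ : ∀ {p q} → 0ℚ ℚ.≤ p → p ℚ.≤ q → ∀ i → p ^ i ℚ.≤ q ^ i
  ^-mono-≤ 0≤p p≤q zero    = ℚ.≤-refl
  ^-mono-≤ {p} {q} 0≤p p≤q (suc i) = ℚ.≤-trans
    (*-monoˡ-≤ 0≤p (^-mono-≤ 0≤p p≤q i))
    (*-monoʳ-≤ (0≤^ (ℚ.≤-trans 0≤p p≤q) i) p≤q)

  -- The tangent of z ↦ zⁱ⁺¹ at x + t lies below the graph at x.
  ^-tangent : ∀ {x t} → 0ℚ ℚ.≤ x → 0ℚ ℚ.≤ t → ∀ i →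
    (x ℚ.+ t) ^ suc i ℚ.≤ x ^ suc i ℚ.+ fromℕ (suc i) ℚ.* (t ℚ.* (x ℚ.+ t) ^ i)
  ^-tangent {x} {t} 0≤x 0≤t zero = ℚ.≤-reflexive
    (solve 2 (λ x t → (x :+ t) :* con 1ℚ := x :* con 1ℚ :+ con 1ℚ :* (t :* con 1ℚ)) refl x t)
  ^-tangent {x} {t} 0≤x 0≤t (suc i) = begin
    y ℚ.* (y ℚ.* p)                                         ≡⟨ ℚ.*-distribʳ-+ (y ℚ.* p) x t ⟩
    x ℚ.* (y ℚ.* p) ℚ.+ t ℚ.* (y ℚ.* p)                     ≤⟨ ℚ.+-monoˡ-≤ _ (*-monoˡ-≤ 0≤x (^-tangent 0≤x 0≤t i)) ⟩
    -- The added term `t * t * (s * p)` completes the factor `x` in front of `s * (t * p)` to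
    -- `y = x + t`.
    x ℚ.* (w ℚ.+ s ℚ.* (t ℚ.* p)) ℚ.+ t ℚ.* (y ℚ.* p)       ≤⟨ ≤-addʳ _ (0≤* (0≤* 0≤t 0≤t) (0≤* (0≤fromℕ (suc i)) (0≤^ (ℚ.+-mono-≤ 0≤x 0≤t) i))) ⟩
    x ℚ.* (w ℚ.+ s ℚ.* (t ℚ.* p)) ℚ.+ t ℚ.* (y ℚ.* p) ℚ.+ t ℚ.* t ℚ.* (s ℚ.* p)
      ≡⟨ solve 5 (λ x t s p w → x :* (w :+ s :* (t :* p)) :+ t :* ((x :+ t) :* p) :+ t :* t :* (s :* p)
                   := x :* w :+ (con 1ℚ :+ s) :* (t :* ((x :+ t) :* p))) refl x t s p w ⟩
    x ℚ.* w ℚ.+ (1ℚ ℚ.+ s) ℚ.* (t ℚ.* (y ℚ.* p))            ≡⟨ cong (λ z → x ℚ.* w ℚ.+ z ℚ.* (t ℚ.* (y ℚ.* p))) (fromℕ-+ 1 (suc i)) ⟨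
    x ℚ.* w ℚ.+ fromℕ (suc (suc i)) ℚ.* (t ℚ.* (y ℚ.* p))   ∎
    where
    open ℚ.≤-Reasoning
    y = x ℚ.+ t
    p = y ^ i
    w = x ^ suc i
    s = fromℕ (suc i)

  0≤expSum : ∀ {x} → 0ℚ ℚ.≤ x → ∀ m → 0ℚ ℚ.≤ expSum x m
  0≤expSum 0≤x zero    = ℚ.≤-refl
  0≤expSum 0≤x (suc m) = ℚ.+-mono-≤ (0≤expSum 0≤x m) (0≤* (0≤^ 0≤x m) (0≤1/! m))

  expSum-suc-≤ : ∀ {x} → 0ℚ ℚ.≤ x → ∀ m → expSum x m ℚ.≤ expSum x (suc m)
  expSum-suc-≤ 0≤x m = ≤-addʳ _ (0≤* (0≤^ 0≤x m) (0≤1/! m))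

  expSum-+-≤ : ∀ {x} → 0ℚ ℚ.≤ x → ∀ m d → expSum x m ℚ.≤ expSum x (d ℕ.+ m)
  expSum-+-≤ 0≤x m zero    = ℚ.≤-refl
  expSum-+-≤ 0≤x m (suc d) = ℚ.≤-trans (expSum-+-≤ 0≤x m d) (expSum-suc-≤ 0≤x (d ℕ.+ m))

  expSum-mono-≤ : ∀ {x y} → 0ℚ ℚ.≤ x → x ℚ.≤ y → ∀ m → expSum x m ℚ.≤ expSum y m
  expSum-mono-≤ 0≤x x≤y zero    = ℚ.≤-refl
  expSum-mono-≤ 0≤x x≤y (suc m) =
    ℚ.+-mono-≤ (expSum-mono-≤ 0≤x x≤y m) (*-monoʳ-≤ (0≤1/! m) (^-mono-≤ 0≤x x≤y m))

  -- All terms after the first vanish; equality fails only for the empty sum.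
  expSum-0-≤1 : ∀ m → expSum 0ℚ m ℚ.≤ 1ℚ
  expSum-0-≤1 zero          = ℚ.nonNegative⁻¹ 1ℚ
  expSum-0-≤1 (suc zero)    = ℚ.≤-refl
  expSum-0-≤1 (suc (suc m)) = begin
    expSum 0ℚ (suc m) ℚ.+ 0ℚ ^ suc m ℚ.* 1/ suc m !
      ≡⟨ solve 3 (λ e p f → e :+ con 0ℚ :* p :* f := e) refl (expSum 0ℚ (suc m)) (0ℚ ^ m) (1/ suc m !) ⟩
    expSum 0ℚ (suc m)         ≤⟨ expSum-0-≤1 (suc m) ⟩
    1ℚ                        ∎
    where open ℚ.≤-Reasoning

  -- The tangent bound for powers is summed term by term. Differentiation lowers every degree by
  -- one, so the slope is a partial sum with one term fewer.
  expSum-tangent-suc : ∀ {x t} → 0ℚ ℚ.≤ x → 0ℚ ℚ.≤ t → ∀ m →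
    expSum (x ℚ.+ t) (suc m) ℚ.≤ expSum x (suc m) ℚ.+ t ℚ.* expSum (x ℚ.+ t) m
  expSum-tangent-suc {x} {t} 0≤x 0≤t zero =
    ℚ.≤-reflexive (solve 1 (λ t → con 1ℚ := con 1ℚ :+ t :* con 0ℚ) refl t)
  expSum-tangent-suc {x} {t} 0≤x 0≤t (suc m) = begin
    expSum y (suc m) ℚ.+ y ^ suc m ℚ.* g
      ≤⟨ ℚ.+-mono-≤ (expSum-tangent-suc 0≤x 0≤t m) (*-monoʳ-≤ (0≤1/! (suc m)) (^-tangent 0≤x 0≤t m)) ⟩
    (a ℚ.+ t ℚ.* b) ℚ.+ (x ^ suc m ℚ.+ s ℚ.* (t ℚ.* y ^ m)) ℚ.* g
      ≡⟨ solve 7 (λ a t b c s p g → (a :+ t :* b) :+ (c :+ s :* (t :* p)) :* g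
                   := (a :+ c :* g) :+ t :* (b :+ p :* (s :* g))) refl a t b (x ^ suc m) s (y ^ m) g ⟩
    (a ℚ.+ x ^ suc m ℚ.* g) ℚ.+ t ℚ.* (b ℚ.+ y ^ m ℚ.* (s ℚ.* g))
      ≡⟨ cong (λ z → (a ℚ.+ x ^ suc m ℚ.* g) ℚ.+ t ℚ.* (b ℚ.+ y ^ m ℚ.* z)) (1/[1+m]! m) ⟩
    expSum x (suc (suc m)) ℚ.+ t ℚ.* expSum y (suc m) ∎
    where
    open ℚ.≤-Reasoning
    y = x ℚ.+ t
    a = expSum x (suc m)
    b = expSum y m
    s = fromℕ (suc m)
    g = 1/ suc m !

  -- Enlarges the slope so that all partial sums have the same length and the estimate can be
  -- iterated at fixed `m`.
  expSum-tangent : ∀ {x t} → 0ℚ ℚ.≤ x → 0ℚ ℚ.≤ t → ∀ m →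
    expSum (x ℚ.+ t) m ℚ.≤ expSum x m ℚ.+ t ℚ.* expSum (x ℚ.+ t) m
  expSum-tangent {x} {t} 0≤x 0≤t zero =
    ℚ.≤-reflexive (solve 1 (λ t → con 0ℚ := con 0ℚ :+ t :* con 0ℚ) refl t)
  expSum-tangent {x} {t} 0≤x 0≤t (suc m) = ℚ.≤-trans
    (expSum-tangent-suc 0≤x 0≤t m)
    (ℚ.+-monoʳ-≤ (expSum x (suc m)) (*-monoˡ-≤ 0≤t (expSum-suc-≤ (ℚ.+-mono-≤ 0≤x 0≤t) m)))

  -- Comparison of the exponential with powers of 1 - q / v.

  module _ {v w q : ℕ} .{{_ : NonZero v}} (w+q≡v : w ℕ.+ q ≡ v) where
    private
      t = fromℕ q ℚ.* (+ 1 / v)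

      0≤t : 0ℚ ℚ.≤ t
      0≤t = 0≤* (0≤fromℕ q) (0≤1/ v)

      v*t≡q : fromℕ v ℚ.* t ≡ fromℕ q
      v*t≡q = begin
        fromℕ v ℚ.* (fromℕ q ℚ.* (+ 1 / v))   ≡⟨ solve 3 (λ v q i → v :* (q :* i) := q :* (v :* i)) refl (fromℕ v) (fromℕ q) (+ 1 / v) ⟩
        fromℕ q ℚ.* (fromℕ v ℚ.* (+ 1 / v))   ≡⟨ cong (fromℕ q ℚ.*_) (fromℕ*1/n≡1 v) ⟩
        fromℕ q ℚ.* 1ℚ                        ≡⟨ ℚ.*-identityʳ (fromℕ q) ⟩
        fromℕ q                               ∎
        where open ≡-Reasoning

    -- This is (1 - t) exp (x + t) ≤ exp x multiplied by `v`, since `w = v - q` and `v * t = q`; the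
    -- tangent bound rearranges to it.
    expSum-step : ∀ {x} → 0ℚ ℚ.≤ x → ∀ m → fromℕ w ℚ.* expSum (x ℚ.+ t) m ℚ.≤ fromℕ v ℚ.* expSum x m
    expSum-step {x} 0≤x m = begin
      W ℚ.* b                                                    ≡⟨ solve 3 (λ W Q b → W :* b := (W :+ Q) :* b :+ :- (Q :* b)) refl W Q b ⟩
      (W ℚ.+ Q) ℚ.* b ℚ.+ ℚ.- (Q ℚ.* b)                          ≡⟨ cong (λ z → z ℚ.* b ℚ.+ ℚ.- (Q ℚ.* b)) (trans (sym (fromℕ-+ w q)) (cong fromℕ w+q≡v)) ⟩
      fromℕ v ℚ.* b ℚ.+ ℚ.- (Q ℚ.* b)                            ≤⟨ ℚ.+-monoˡ-≤ _ (*-monoˡ-≤ (0≤fromℕ v) (expSum-tangent 0≤x 0≤t m)) ⟩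
      fromℕ v ℚ.* (a ℚ.+ t ℚ.* b) ℚ.+ ℚ.- (Q ℚ.* b)              ≡⟨ solve 5 (λ v a t b Q → v :* (a :+ t :* b) :+ :- (Q :* b) := v :* a :+ (v :* t :+ :- Q) :* b) refl (fromℕ v) a t b Q ⟩
      fromℕ v ℚ.* a ℚ.+ (fromℕ v ℚ.* t ℚ.+ ℚ.- Q) ℚ.* b          ≡⟨ cong (λ z → fromℕ v ℚ.* a ℚ.+ (z ℚ.+ ℚ.- Q) ℚ.* b) v*t≡q ⟩
      fromℕ v ℚ.* a ℚ.+ (Q ℚ.+ ℚ.- Q) ℚ.* b                      ≡⟨ solve 4 (λ v a Q b → v :* a :+ (Q :+ :- Q) :* b := v :* a) refl (fromℕ v) a Q b ⟩
      fromℕ v ℚ.* a                                              ∎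
      where
      open ℚ.≤-Reasoning
      W = fromℕ w
      Q = fromℕ q
      a = expSum x m
      b = expSum (x ℚ.+ t) m

    -- exp (n t) ≤ (1 - t)⁻ⁿ for t = q / v, cleared of denominators.
    expSum-upper : ∀ n m → fromℕ (w ℕ.^ n) ℚ.* expSum (fromℕ n ℚ.* t) m ℚ.≤ fromℕ (v ℕ.^ n)
    expSum-upper zero m = begin
      1ℚ ℚ.* expSum (0ℚ ℚ.* t) m   ≡⟨ ℚ.*-identityˡ _ ⟩
      expSum (0ℚ ℚ.* t) m          ≡⟨ cong (λ z → expSum z m) (ℚ.*-zeroˡ t) ⟩
      expSum 0ℚ m                  ≤⟨ expSum-0-≤1 m ⟩
      1ℚ                           ∎
      where open ℚ.≤-Reasoning
    expSum-upper (suc n) m = begin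
      fromℕ (w ℕ.* w ℕ.^ n) ℚ.* expSum (fromℕ (suc n) ℚ.* t) m
        ≡⟨ cong₂ (λ z y → z ℚ.* expSum y m) (fromℕ-* w (w ℕ.^ n)) split ⟩
      fromℕ w ℚ.* W ℚ.* expSum (x ℚ.+ t) m
        ≡⟨ solve 3 (λ w W e → w :* W :* e := W :* (w :* e)) refl (fromℕ w) W (expSum (x ℚ.+ t) m) ⟩
      W ℚ.* (fromℕ w ℚ.* expSum (x ℚ.+ t) m)
        ≤⟨ *-monoˡ-≤ (0≤fromℕ (w ℕ.^ n)) (expSum-step (0≤* (0≤fromℕ n) 0≤t) m) ⟩
      W ℚ.* (fromℕ v ℚ.* expSum x m)
        ≡⟨ solve 3 (λ w v e → w :* (v :* e) := v :* (w :* e)) refl W (fromℕ v) (expSum x m) ⟩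
      fromℕ v ℚ.* (W ℚ.* expSum x m)
        ≤⟨ *-monoˡ-≤ (0≤fromℕ v) (expSum-upper n m) ⟩
      fromℕ v ℚ.* fromℕ (v ℕ.^ n)
        ≡⟨ fromℕ-* v (v ℕ.^ n) ⟨
      fromℕ (v ℕ.* v ℕ.^ n) ∎
      where
      open ℚ.≤-Reasoning
      x = fromℕ n ℚ.* t
      W = fromℕ (w ℕ.^ n)
      split : fromℕ (suc n) ℚ.* t ≡ x ℚ.+ t
      split = trans (cong (ℚ._* t) (fromℕ-+ 1 n))
        (solve 2 (λ n t → (con 1ℚ :+ n) :* t := n :* t :+ t) refl (fromℕ n) t)

    -- If v wⁿ > vⁿ, then exp (n t) ≤ vⁿ / wⁿ ≤ v - 1 / wⁿ.
    log-upper⇒ : ∀ n → ¬ log v (fromℕ n ℚ.* fromℕ q ℚ.* (+ 1 / v)) → v ℕ.* w ℕ.^ n ℕ.≤ v ℕ.^ n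
    log-upper⇒ n ¬log = ℕ.≮⇒≥ λ lt → ¬log (below lt (w ℕ.^ n) refl)
      where
      -- The power `w ^ n` enters as a variable `p`, so that matching on it yields a nonzero
      -- denominator for `1 / p`.
      below : v ℕ.^ n ℕ.< v ℕ.* w ℕ.^ n → ∀ p → p ≡ w ℕ.^ n → log v (fromℕ n ℚ.* fromℕ q ℚ.* (+ 1 / v))
      below lt zero      eq = contradiction (subst (λ z → v ℕ.^ n ℕ.< v ℕ.* z) (sym eq) lt)
                                           (λ lt′ → ℕ.n≮0 (subst (v ℕ.^ n ℕ.<_) (ℕ.*-zeroʳ v) lt′))
      -- The integers vⁿ < v wⁿ differ by at least 1, and division by wⁿ turns this gap into the
      -- margin `ε`. The estimate holds for every partial sum, hence the threshold index 0.
      below lt p@(suc _) eq = ε , 0 , ℚ.positive⁻¹ ε {{ℚ.normalize-pos 1 p}} , λ m _ → bound m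
        where
        ε = + 1 / p
        bound : ∀ m → expSum (fromℕ n ℚ.* fromℕ q ℚ.* (+ 1 / v)) m ℚ.+ ε ℚ.≤ fromℕ v
        bound m = ℚ.*-cancelˡ-≤-pos (fromℕ p) {{ℚ.normalize-pos p 1}} (begin
          fromℕ p ℚ.* (expSum (fromℕ n ℚ.* fromℕ q ℚ.* (+ 1 / v)) m ℚ.+ ε)
            ≡⟨ cong (λ z → fromℕ p ℚ.* (expSum z m ℚ.+ ε)) (ℚ.*-assoc (fromℕ n) (fromℕ q) (+ 1 / v)) ⟩
          fromℕ p ℚ.* (e ℚ.+ ε)
            ≡⟨ ℚ.*-distribˡ-+ (fromℕ p) e ε ⟩
          fromℕ p ℚ.* e ℚ.+ fromℕ p ℚ.* ε
            ≡⟨ cong₂ (λ y z → fromℕ y ℚ.* e ℚ.+ z) eq (fromℕ*1/n≡1 p) ⟩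
          fromℕ (w ℕ.^ n) ℚ.* e ℚ.+ 1ℚ
            ≤⟨ ℚ.+-monoˡ-≤ 1ℚ (expSum-upper n m) ⟩
          fromℕ (v ℕ.^ n) ℚ.+ 1ℚ
            ≡⟨ fromℕ-+ (v ℕ.^ n) 1 ⟨
          fromℕ (v ℕ.^ n ℕ.+ 1)
            ≤⟨ fromℕ-mono-≤ (subst (ℕ._≤ v ℕ.* w ℕ.^ n) (ℕ.+-comm 1 (v ℕ.^ n)) lt) ⟩
          fromℕ (v ℕ.* w ℕ.^ n)
            ≡⟨ cong (λ z → fromℕ (v ℕ.* z)) eq ⟨
          fromℕ (v ℕ.* p)
            ≡⟨ trans (fromℕ-* v p) (ℚ.*-comm (fromℕ v) (fromℕ p)) ⟩
          fromℕ p ℚ.* fromℕ v ∎)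
          where
          open ℚ.≤-Reasoning
          e = expSum (fromℕ n ℚ.* t) m

  -- 1 + q + q²/2 + q³/6 + q⁴/24 - (1 + q + q²) = q² (q - 2) (q + 6) / 24.
  expSum-5-lower : ∀ q → 2 ℕ.≤ q → fromℕ (1 ℕ.+ q ℕ.+ q ℕ.* q) ℚ.≤ expSum (fromℕ q) 5
  expSum-5-lower q 2≤q = begin
    fromℕ (1 ℕ.+ q ℕ.+ q ℕ.* q)
      ≡⟨ trans (fromℕ-+ (1 ℕ.+ q) (q ℕ.* q)) (cong₂ ℚ._+_ (fromℕ-+ 1 q) (fromℕ-* q q)) ⟩
    1ℚ ℚ.+ x ℚ.+ x ℚ.* x
      ≤⟨ ≤-addʳ _ (0≤* (0≤* (0≤1/ 24) (0≤* (0≤fromℕ q) (0≤fromℕ q))) (0≤* (0≤fromℕ (q ℕ.∸ 2)) (0≤fromℕ (q ℕ.+ 6)))) ⟩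
    1ℚ ℚ.+ x ℚ.+ x ℚ.* x ℚ.+ + 1 / 24 ℚ.* (x ℚ.* x) ℚ.* (fromℕ (q ℕ.∸ 2) ℚ.* fromℕ (q ℕ.+ 6))
      ≡⟨ cong₂ (λ y z → 1ℚ ℚ.+ x ℚ.+ x ℚ.* x ℚ.+ + 1 / 24 ℚ.* (x ℚ.* x) ℚ.* (y ℚ.* z)) q-2 (fromℕ-+ q 6) ⟩
    1ℚ ℚ.+ x ℚ.+ x ℚ.* x ℚ.+ + 1 / 24 ℚ.* (x ℚ.* x) ℚ.* ((x ℚ.+ ℚ.- fromℕ 2) ℚ.* (x ℚ.+ fromℕ 6))
      ≡⟨ solve 1 (λ x → con 1ℚ :+ x :+ x :* x :+ con (+ 1 / 24) :* (x :* x) :* ((x :+ :- con (fromℕ 2)) :* (x :+ con (fromℕ 6)))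
           := con 0ℚ :+ con 1ℚ :* con (1/ 0 !) :+ x :* con 1ℚ :* con (1/ 1 !) :+ x :* (x :* con 1ℚ) :* con (1/ 2 !)
              :+ x :* (x :* (x :* con 1ℚ)) :* con (1/ 3 !) :+ x :* (x :* (x :* (x :* con 1ℚ))) :* con (1/ 4 !)) refl x ⟩
    expSum x 5 ∎
    where
    open ℚ.≤-Reasoning
    x = fromℕ q
    q-2 : fromℕ (q ℕ.∸ 2) ≡ x ℚ.+ ℚ.- fromℕ 2
    q-2 = trans (solve 1 (λ y → y := con (fromℕ 2) :+ y :+ :- con (fromℕ 2)) refl (fromℕ (q ℕ.∸ 2)))
      (cong (ℚ._+ ℚ.- fromℕ 2) (trans (sym (fromℕ-+ 2 (q ℕ.∸ 2))) (cong fromℕ (ℕ.m+[n∸m]≡n 2≤q))))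

  -- exp q ≥ 1 + q + q² ≥ v, so q ≥ log v.
  log-lower⇒ : ∀ v .{{_ : NonZero v}} {q} → 2 ℕ.≤ q → v ℕ.≤ 1 ℕ.+ q ℕ.+ q ℕ.* q →
    ∀ n → log v ((fromℕ n ℚ.- 1ℚ) ℚ.* fromℕ q ℚ.* (+ 1 / v)) → n ℕ.≤ v
  log-lower⇒ v {q} 2≤q v≤ n (ε , N , 0<ε , bound) = ℕ.≮⇒≥ λ v<n → ℚ.<-irrefl refl (begin-strict
    fromℕ v                                     ≤⟨ fromℕ-mono-≤ v≤ ⟩
    fromℕ (1 ℕ.+ q ℕ.+ q ℕ.* q)                 ≤⟨ expSum-5-lower q 2≤q ⟩
    -- The cut bounds the partial sums only from index `N` on, so the five-term estimate is carried
    -- to `N + 5` terms.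
    expSum (fromℕ q) 5                          ≤⟨ expSum-+-≤ (0≤fromℕ q) 5 N ⟩
    expSum (fromℕ q) (N ℕ.+ 5)                  ≤⟨ expSum-mono-≤ (0≤fromℕ q) (q≤r v<n) (N ℕ.+ 5) ⟩
    expSum r (N ℕ.+ 5)                          ≡⟨ ℚ.+-identityʳ _ ⟨
    expSum r (N ℕ.+ 5) ℚ.+ 0ℚ                   <⟨ ℚ.+-monoʳ-< (expSum r (N ℕ.+ 5)) 0<ε ⟩
    expSum r (N ℕ.+ 5) ℚ.+ ε                    ≤⟨ bound (N ℕ.+ 5) (ℕ.m≤m+n N 5) ⟩
    fromℕ v                                     ∎)
    where
    open ℚ.≤-Reasoning
    r = (fromℕ n ℚ.- 1ℚ) ℚ.* fromℕ q ℚ.* (+ 1 / v)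
    -- If `v < n`, then `n - 1` is at least `v`, which cancels the division by `v`.
    q≤r : v ℕ.< n → fromℕ q ℚ.≤ r
    q≤r v<n = begin
      fromℕ q                                            ≡⟨ ℚ.*-identityʳ (fromℕ q) ⟨
      fromℕ q ℚ.* 1ℚ                                     ≡⟨ cong (fromℕ q ℚ.*_) (fromℕ*1/n≡1 v) ⟨
      fromℕ q ℚ.* (fromℕ v ℚ.* (+ 1 / v))                ≡⟨ solve 3 (λ q v i → q :* (v :* i) := (con 1ℚ :+ v :+ :- con 1ℚ) :* q :* i) refl (fromℕ q) (fromℕ v) (+ 1 / v) ⟩
      (1ℚ ℚ.+ fromℕ v ℚ.- 1ℚ) ℚ.* fromℕ q ℚ.* (+ 1 / v)  ≡⟨ cong (λ z → (z ℚ.- 1ℚ) ℚ.* fromℕ q ℚ.* (+ 1 / v)) (fromℕ-+ 1 v) ⟨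
      (fromℕ (suc v) ℚ.- 1ℚ) ℚ.* fromℕ q ℚ.* (+ 1 / v)   ≤⟨ *-monoʳ-≤ (0≤1/ v) (*-monoʳ-≤ (0≤fromℕ q) (ℚ.+-monoˡ-≤ (ℚ.- 1ℚ) (fromℕ-mono-≤ v<n))) ⟩
      r                                                  ∎

-- Sums over Fin n and cardinalities of subsets

module Σ = Algebra.Properties.Semiring.Sum ℕ.+-*-semiring
open Σ using (sum)
open import Data.Nat.Base using (_^_)
open ℕSolver.+-*-Solver using (solve; _:=_; _:+_; _:*_; con)

sum-mono-≤ : ∀ {n} {f g : Fin n → ℕ} → (∀ i → f i ≤ g i) → sum f ≤ sum g
sum-mono-≤ {zero}  f≤g = z≤n
sum-mono-≤ {suc n} f≤g = ℕ.+-mono-≤ (f≤g zero) (sum-mono-≤ (f≤g ∘ suc))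

sum-mono-< : ∀ {n} {f g : Fin n → ℕ} → (∀ i → f i ≤ g i) → ∀ i → f i < g i → sum f < sum g
sum-mono-< f≤g zero    f<g = ℕ.+-mono-<-≤ f<g (sum-mono-≤ (f≤g ∘ suc))
sum-mono-< f≤g (suc i) f<g = ℕ.+-mono-≤-< (f≤g zero) (sum-mono-< (f≤g ∘ suc) i f<g)

sum-const : ∀ n c → sum {n} (λ _ → c) ≡ n * c
sum-const zero    c = refl
sum-const (suc n) c = cong (c +_) (sum-const n c)

term≤sum : ∀ {n} (f : Fin n → ℕ) i → f i ≤ sum f
term≤sum f zero    = ℕ.m≤m+n _ _
term≤sum f (suc i) = ℕ.≤-trans (term≤sum (f ∘ suc) i) (ℕ.m≤n+m _ (f zero))

sum-const-off : ∀ {n} (f : Fin (suc n) → ℕ) i {c} → (∀ {j} → j ≢ i → f j ≡ c) → sum f ≡ f i + n * c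
sum-const-off {n} f i {c} f≡c = begin
  sum f                          ≡⟨ Σ.sum-remove {i = i} f ⟩
  f i + sum (f ∘ punchIn i)      ≡⟨ cong (f i +_) (Σ.sum-cong-≗ (λ j → f≡c (Fin.punchInᵢ≢i i j))) ⟩
  f i + sum {n} (λ _ → c)        ≡⟨ cong (f i +_) (sum-const n c) ⟩
  f i + n * c                    ∎
  where open ≡-Reasoning

-- Pigeonhole: if every term were below `c`, the sum would be below `n * c`. Strictness needs one
-- index, which exists because `n` is nonzero.
average≤some : ∀ {n} .{{_ : NonZero n}} (f : Fin n → ℕ) c → n * c ≤ sum f → ∃ λ i → c ≤ f i
average≤some {suc n} f c nc≤ with Fin.any? (λ i → c ℕ.≤? f i)
... | yes found = found
... | no ¬found = contradiction nc≤ (ℕ.<⇒≱ (subst (sum f <_) (sum-const (suc n) c)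
        (sum-mono-< (λ i → ℕ.<⇒≤ (f<c i)) zero (f<c zero))))
  where
  f<c : ∀ i → f i < c
  f<c i = ℕ.≰⇒> (λ c≤fi → ¬found (i , c≤fi))

-- Indicators of Booleans and sizes of subsets.

𝟙 : Bool → ℕ
𝟙 b = if b then 1 else 0

𝟙≤1 : ∀ b → 𝟙 b ≤ 1
𝟙≤1 true  = ℕ.≤-refl
𝟙≤1 false = z≤n

𝟙-∧ : ∀ a b → 𝟙 (a ∧ b) ≡ 𝟙 a * 𝟙 b
𝟙-∧ true  true  = refl
𝟙-∧ true  false = refl
𝟙-∧ false b     = refl

𝟙-split : ∀ a b → 𝟙 (a ∧ not b) + 𝟙 a * 𝟙 b ≡ 𝟙 a
𝟙-split true  true  = refl
𝟙-split true  false = refl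
𝟙-split false b     = refl

-- Inclusion and exclusion for a symmetric difference, kept additive to avoid truncated subtraction.
𝟙-xor : ∀ a b → 𝟙 (a xor b) + (𝟙 a * 𝟙 b + 𝟙 a * 𝟙 b) ≡ 𝟙 a + 𝟙 b
𝟙-xor true  true  = refl
𝟙-xor true  false = refl
𝟙-xor false true  = refl
𝟙-xor false false = refl

𝟙-idem : ∀ a → 𝟙 a * 𝟙 a ≡ 𝟙 a
𝟙-idem true  = refl
𝟙-idem false = refl

∣p∣≡sum : ∀ {n} (p : Subset n) → ∣ p ∣ ≡ sum (𝟙 ∘ lookup p)
∣p∣≡sum []            = refl
∣p∣≡sum (inside  ∷ p) = cong suc (∣p∣≡sum p)
∣p∣≡sum (outside ∷ p) = ∣p∣≡sum p

∣p∪q∣≤∣p∣+∣q∣ : ∀ {n} (p q : Subset n) → ∣ p ∪ q ∣ ≤ ∣ p ∣ + ∣ q ∣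
∣p∪q∣≤∣p∣+∣q∣ []            []            = z≤n
∣p∪q∣≤∣p∣+∣q∣ (inside  ∷ p) (inside  ∷ q) =
  s≤s (ℕ.≤-trans (∣p∪q∣≤∣p∣+∣q∣ p q) (ℕ.+-monoʳ-≤ ∣ p ∣ (ℕ.n≤1+n ∣ q ∣)))
∣p∪q∣≤∣p∣+∣q∣ (inside  ∷ p) (outside ∷ q) = s≤s (∣p∪q∣≤∣p∣+∣q∣ p q)
∣p∪q∣≤∣p∣+∣q∣ (outside ∷ p) (inside  ∷ q) =
  ℕ.≤-trans (s≤s (∣p∪q∣≤∣p∣+∣q∣ p q)) (ℕ.≤-reflexive (sym (ℕ.+-suc ∣ p ∣ ∣ q ∣)))
∣p∪q∣≤∣p∣+∣q∣ (outside ∷ p) (outside ∷ q) = ∣p∪q∣≤∣p∣+∣q∣ p q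

superset-of-size : ∀ {v} (p : Subset v) n → ∣ p ∣ ≤ n → n ≤ v → ∃ λ q → p ⊆ q × ∣ q ∣ ≡ n
superset-of-size []            zero    _         _         = [] , (λ x∈p → x∈p) , refl
superset-of-size (inside ∷ p)  (suc n) (s≤s p≤n) (s≤s n≤v)
  with q , p⊆q , ∣q∣≡n ← superset-of-size p n p≤n n≤v =
  inside ∷ q , (λ { here → here ; (there x∈p) → there (p⊆q x∈p) }) , cong suc ∣q∣≡n
superset-of-size {suc v} (outside ∷ p) n p≤n n≤1+v with n ℕ.≤? v
... | yes n≤v with q , p⊆q , ∣q∣≡n ← superset-of-size p n p≤n n≤v =
  outside ∷ q , (λ { (there x∈p) → there (p⊆q x∈p) }) , ∣q∣≡n
-- Leaving this position out would leave too few others, so `n` equals `suc v` and the full set is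
-- forced.
... | no n≰v = ⊤ , (λ _ → ∈⊤) , trans (∣⊤∣≡n (suc v)) (ℕ.≤-antisym (ℕ.≰⇒> n≰v) n≤1+v)

0<∣p∣⇒Nonempty : ∀ {n} (p : Subset n) → 0 < ∣ p ∣ → Nonempty p
0<∣p∣⇒Nonempty {n} p 0<∣p∣ with nonempty? p
... | yes ne    = ne
... | no  empty = contradiction (trans (cong ∣_∣ (Empty-unique empty)) (∣⊥∣≡0 n)) (ℕ.>⇒≢ 0<∣p∣)

-- The greedy covering algorithm

module GreedyCover {v N w d : ℕ} .{{_ : NonZero v}} (w+d≡v : w + d ≡ v)
  (covers : Fin v → Fin N → Bool) where

  size : (Fin N → Bool) → ℕ
  size E = sum (𝟙 ∘ E)

  without : (Fin N → Bool) → Fin v → Fin N → Bool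
  without E B e = E e ∧ not (covers B e)

  WellCovered : (Fin N → Bool) → Set
  WellCovered E = ∀ e → E e ≡ true → d ≤ sum (λ B → 𝟙 (covers B e))

  -- `WellCovered` counts all covering sets, including those already chosen, so it passes to any
  -- smaller `E`.
  without-wellCovered : ∀ {E} → WellCovered E → ∀ B → WellCovered (without E B)
  without-wellCovered {E} wc B e e∈ = wc e (proj-∧ (E e) e∈)
    where
    proj-∧ : ∀ a {b} → a ∧ b ≡ true → a ≡ true
    proj-∧ true _ = refl

  -- Some B covers at least the average number d |E| / v of elements of E.
  greedy-step : ∀ {E} → WellCovered E → ∃ λ B → v * size (without E B) ≤ w * size E
  -- Since `w` is `v - d`, the term `d * size E` is added to both sides instead of being subtracted.
  greedy-step {E} wc = B , ℕ.+-cancelʳ-≤ (d * size E) _ _ (begin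
    v * size (without E B) + d * size E              ≤⟨ ℕ.+-monoʳ-≤ (v * size (without E B)) d∣E∣≤ ⟩
    v * size (without E B) + v * hit B               ≡⟨ ℕ.*-distribˡ-+ v (size (without E B)) (hit B) ⟨
    v * (size (without E B) + hit B)                 ≡⟨ cong (v *_) (Σ.∑-distrib-+ (𝟙 ∘ without E B) (λ e → 𝟙 (E e) * 𝟙 (covers B e))) ⟨
    v * sum (λ e → 𝟙 (without E B e) + 𝟙 (E e) * 𝟙 (covers B e)) ≡⟨ cong (v *_) (Σ.sum-cong-≗ (λ e → 𝟙-split (E e) (covers B e))) ⟩
    v * size E                                       ≡⟨ cong (_* size E) w+d≡v ⟨
    (w + d) * size E                                 ≡⟨ ℕ.*-distribʳ-+ (size E) w d ⟩
    w * size E + d * size E                          ∎)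
    where
    open ℕ.≤-Reasoning
    hit : Fin v → ℕ
    hit B = sum (λ e → 𝟙 (E e) * 𝟙 (covers B e))

    pointwise : ∀ e → d * 𝟙 (E e) ≤ sum (λ B → 𝟙 (E e) * 𝟙 (covers B e))
    pointwise e with E e in eq
    ... | true  = begin
      d * 1                              ≡⟨ ℕ.*-identityʳ d ⟩
      d                                  ≤⟨ wc e eq ⟩
      sum (λ B → 𝟙 (covers B e))         ≡⟨ Σ.sum-cong-≗ (λ B → sym (ℕ.+-identityʳ (𝟙 (covers B e)))) ⟩
      sum (λ B → 1 * 𝟙 (covers B e))     ∎
    ... | false = ℕ.≤-trans (ℕ.≤-reflexive (ℕ.*-zeroʳ d)) z≤n

    -- Double counting of the pairs formed by an element of `E` and a set covering it.
    d∣E∣≤sum : d * size E ≤ sum hit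
    d∣E∣≤sum = begin
      d * size E                                             ≡⟨ Σ.*-distribˡ-sum d (𝟙 ∘ E) ⟩
      sum (λ e → d * 𝟙 (E e))                                ≤⟨ sum-mono-≤ pointwise ⟩
      sum (λ e → sum (λ B → 𝟙 (E e) * 𝟙 (covers B e)))       ≡⟨ Σ.∑-comm (λ e B → 𝟙 (E e) * 𝟙 (covers B e)) ⟩
      sum hit                                                ∎

    best : ∃ λ B → d * size E ≤ v * hit B
    -- The values `v * hit B` are averaged, which avoids dividing by `v`.
    best = average≤some (λ B → v * hit B) (d * size E)
      (ℕ.≤-trans (ℕ.*-monoʳ-≤ v d∣E∣≤sum) (ℕ.≤-reflexive (Σ.*-distribˡ-sum v hit)))

    B = proj₁ best
    d∣E∣≤ = proj₂ best

  CoveredBy : Subset v → Fin N → Set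
  CoveredBy S e = ∃ λ B → B ∈ S × covers B e ≡ true

  -- `E′` is what remains after `n` greedy choices; each choice multiplies the size of the remainder
  -- by at most w / v.
  greedy : ∀ n E → WellCovered E → ∃ λ S → ∃ λ E′ → ∣ S ∣ ≤ n × v ^ n * size E′ ≤ w ^ n * size E ×
    (∀ e → E e ≡ true → E′ e ≡ true ⊎ CoveredBy S e)
  greedy zero    E wc = ⊥ , E , ℕ.≤-reflexive (∣⊥∣≡0 v) , ℕ.≤-refl , λ e e∈E → inj₁ e∈E
  greedy (suc n) E wc =
    let B , shrink = greedy-step wc
        S , E′ , ∣S∣≤n , decay , rest = greedy n (without E B) (without-wellCovered wc B)
        open ℕ.≤-Reasoning
    in ⁅ B ⁆ ∪ S , E′ ,
      (begin
        ∣ ⁅ B ⁆ ∪ S ∣         ≤⟨ ∣p∪q∣≤∣p∣+∣q∣ ⁅ B ⁆ S ⟩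
        ∣ ⁅ B ⁆ ∣ + ∣ S ∣     ≡⟨ cong (_+ ∣ S ∣) (∣⁅x⁆∣≡1 B) ⟩
        suc ∣ S ∣             ≤⟨ s≤s ∣S∣≤n ⟩
        suc n                 ∎) ,
      (begin
        v * v ^ n * size E′                ≡⟨ ℕ.*-assoc v (v ^ n) (size E′) ⟩
        v * (v ^ n * size E′)              ≤⟨ ℕ.*-monoʳ-≤ v decay ⟩
        v * (w ^ n * size (without E B))   ≡⟨ solve 3 (λ a b c → a :* (b :* c) := b :* (a :* c)) refl v (w ^ n) (size (without E B)) ⟩
        w ^ n * (v * size (without E B))   ≤⟨ ℕ.*-monoʳ-≤ (w ^ n) shrink ⟩
        w ^ n * (w * size E)               ≡⟨ solve 3 (λ a b c → b :* (a :* c) := a :* b :* c) refl w (w ^ n) (size E) ⟩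
        w * w ^ n * size E                 ∎) ,
      λ e e∈E → covered-or-left B S E′ rest e e∈E
    where
    covered-or-left : ∀ B S E′ →
      (∀ e → without E B e ≡ true → E′ e ≡ true ⊎ CoveredBy S e) →
      ∀ e → E e ≡ true → E′ e ≡ true ⊎ CoveredBy (⁅ B ⁆ ∪ S) e
    covered-or-left B S E′ rest e e∈E with covers B e in covered
    -- An element covered by `B` is settled at once; any other survives into `without E B` and is
    -- handled by the recursion.
    ... | true  = inj₂ (B , p⊆p∪q S (x∈⁅x⁆ B) , covered)
    ... | false with rest e (cong₂ (λ a b → a ∧ not b) e∈E covered)
    ...   | inj₁ e∈E′          = inj₁ e∈E′
    ...   | inj₂ (C , C∈S , c) = inj₂ (C , q⊆p∪q ⁅ B ⁆ S C∈S , c)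

  -- The remainder has size at most (w / v)ⁿ times that of `E`, which is below 1, so it is empty.
  cover : ∀ {n E} → WellCovered E → size E < N → N * w ^ n ≤ v ^ n →
    ∃ λ S → ∣ S ∣ ≤ n × (∀ e → E e ≡ true → CoveredBy S e)
  cover {n} {E} wc ∣E∣<N enough with greedy n E wc
  ... | S , E′ , ∣S∣≤n , decay , rest = S , ∣S∣≤n , covered
    where
    open ℕ.≤-Reasoning
    E′-empty : ¬ (0 < size E′)
    E′-empty 0<∣E′∣ = ℕ.<⇒≱ ∣E∣<N (ℕ.*-cancelˡ-≤ (w ^ n) {{>-nonZero 0<wⁿ}} (begin
      w ^ n * N         ≡⟨ ℕ.*-comm (w ^ n) N ⟩
      N * w ^ n         ≤⟨ enough ⟩
      v ^ n             ≤⟨ vⁿ≤ ⟩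
      w ^ n * size E    ∎))
      where
      vⁿ≤ : v ^ n ≤ w ^ n * size E
      vⁿ≤ = begin
        v ^ n             ≡⟨ ℕ.*-identityʳ (v ^ n) ⟨
        v ^ n * 1         ≤⟨ ℕ.*-monoʳ-≤ (v ^ n) 0<∣E′∣ ⟩
        v ^ n * size E′   ≤⟨ decay ⟩
        w ^ n * size E    ∎

      -- Cancelling `w ^ n` is legitimate: if it vanished, a nonempty remainder would give
      -- `v ^ n ≤ 0`.
      0<wⁿ : 0 < w ^ n
      0<wⁿ = ℕ.n≢0⇒n>0 λ wⁿ≡0 → ℕ.<⇒≱ (ℕ.m^n>0 v n)
        (ℕ.≤-trans vⁿ≤ (ℕ.≤-reflexive (cong (_* size E) wⁿ≡0)))

    covered : ∀ e → E e ≡ true → CoveredBy S e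
    covered e e∈E with rest e e∈E
    ... | inj₂ c    = c
    ... | inj₁ e∈E′ = contradiction
      (ℕ.≤-trans (ℕ.≤-reflexive (cong 𝟙 (sym e∈E′))) (term≤sum (𝟙 ∘ E′) e)) E′-empty

-- Covering the pairs of distinct points.

distinct : ∀ {v} → Fin v → Fin v → Bool
distinct x y = not ⌊ x Fin.≟ y ⌋

distinct⁻ : ∀ {v} {x y : Fin v} → distinct x y ≡ true → x ≢ y
distinct⁻ {x = x} {y} d with x Fin.≟ y
... | no x≢y = x≢y
... | yes _  = contradiction d λ ()

distinct⁺ : ∀ {v} {x y : Fin v} → x ≢ y → distinct x y ≡ true
distinct⁺ {x = x} {y} x≢y with x Fin.≟ y
... | no _    = refl
... | yes x≡y = contradiction x≡y x≢y

distinct-refl : ∀ {v} (x : Fin v) → distinct x x ≡ false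
distinct-refl x with x Fin.≟ x
... | yes _  = refl
... | no x≢x = contradiction refl x≢x

-- The diagonal, nonempty because of x₀, keeps the number of pairs strictly below v².
cover-pairs : ∀ {v w d n} .{{_ : NonZero v}} → w + d ≡ v → Fin v → (sep : Fin v → Fin v → Fin v → Bool) →
  (∀ {x y} → x ≢ y → d ≤ sum (λ B → 𝟙 (sep B x y))) → v * v * w ^ n ≤ v ^ n →
  ∃ λ S → ∣ S ∣ ≤ n × (∀ {x y} → x ≢ y → ∃ λ B → B ∈ S × sep B x y ≡ true)
cover-pairs {v} {w} {d} {n} w+d≡v x₀ sep enough-sep enough =
  let S , ∣S∣≤n , covered = cover pairs-wellCovered ∣Pairs∣<v² enough
  in S , ∣S∣≤n , λ {x} {y} x≢y →
    let B , B∈S , c = covered (combine x y) (trans (cong (uncurry distinct) (Fin.remQuot-combine x y)) (distinct⁺ x≢y))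
    in B , B∈S , trans (sym (cong (uncurry (sep B)) (Fin.remQuot-combine x y))) c
  where
  pair : Fin (v * v) → Fin v × Fin v
  pair = remQuot v

  -- The elements to be covered are ordered pairs, coded in `Fin (v * v)`; `Pairs` selects those off
  -- the diagonal.
  open GreedyCover {N = v * v} {w} {d} w+d≡v (λ B e → uncurry (sep B) (pair e))

  Pairs : Fin (v * v) → Bool
  Pairs e = uncurry distinct (pair e)

  pairs-wellCovered : WellCovered Pairs
  pairs-wellCovered e e∈ = enough-sep (distinct⁻ e∈)

  ∣Pairs∣<v² : size Pairs < v * v
  ∣Pairs∣<v² = subst (size Pairs <_) (trans (sum-const (v * v) 1) (ℕ.*-identityʳ (v * v)))
    (sum-mono-< (λ e → 𝟙≤1 (Pairs e)) (combine x₀ x₀) (ℕ.≤-reflexive (cong (suc ∘ 𝟙)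
      (trans (cong (uncurry distinct) (Fin.remQuot-combine x₀ x₀)) (distinct-refl x₀)))))

-- From v (v - q)ⁿ ≤ vⁿ, squaring and using v (v - 2q) ≤ (v - q)².
square-bound : ∀ {v w q} .{{_ : NonZero v}} → w + (q + q) ≡ v → ∀ n →
  v * (w + q) ^ n ≤ v ^ n → v * v * w ^ n ≤ v ^ n
square-bound {v} {w} {q} eq n h = ℕ.*-cancelˡ-≤ (v ^ n) {{ℕ.m^n≢0 v n}} (begin
  v ^ n * (v * v * w ^ n)          ≡⟨ solve 3 (λ p v y → p :* (v :* v :* y) := v :* v :* (p :* y)) refl (v ^ n) v (w ^ n) ⟩
  v * v * (v ^ n * w ^ n)          ≤⟨ ℕ.*-monoʳ-≤ (v * v) (powers n) ⟩
  v * v * (u ^ n * u ^ n)          ≡⟨ solve 2 (λ v p → v :* v :* (p :* p) := v :* p :* (v :* p)) refl v (u ^ n) ⟩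
  v * u ^ n * (v * u ^ n)          ≤⟨ ℕ.*-mono-≤ h h ⟩
  v ^ n * v ^ n                    ∎)
  where
  open ℕ.≤-Reasoning
  u = w + q
  vw≤uu : v * w ≤ u * u
  vw≤uu = begin
    v * w                      ≡⟨ cong (_* w) eq ⟨
    -- The difference between (w + q)² and (w + 2q) w is exactly q².
    (w + (q + q)) * w          ≤⟨ ℕ.m≤m+n _ (q * q) ⟩
    (w + (q + q)) * w + q * q  ≡⟨ solve 2 (λ w q → (w :+ (q :+ q)) :* w :+ q :* q := (w :+ q) :* (w :+ q)) refl w q ⟩
    u * u                      ∎
  powers : ∀ i → v ^ i * w ^ i ≤ u ^ i * u ^ i
  powers zero    = ℕ.≤-refl
  powers (suc i) = begin
    v * v ^ i * (w * w ^ i)    ≡⟨ solve 4 (λ a b c d → a :* b :* (c :* d) := a :* c :* (b :* d)) refl v (v ^ i) w (w ^ i) ⟩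
    v * w * (v ^ i * w ^ i)    ≤⟨ ℕ.*-mono-≤ vw≤uu (powers i) ⟩
    u * u * (u ^ i * u ^ i)    ≡⟨ solve 2 (λ a b → a :* a :* (b :* b) := a :* b :* (a :* b)) refl u (u ^ i) ⟩
    u * u ^ i * (u * u ^ i)    ∎

-- Here v is the number of points minus one.  With a = l + 2q - 1 the equation reads
-- l (v - a) = q (q - 1); both factors are positive, so their sum is at most their product plus one.
parameter-bounds : ∀ {v l q} → 2 ≤ q → (l + q) * (l + q ∸ 1) ≡ v * l →
  NonZero l × q + q ≤ suc v × suc v ≤ 1 + q + q * q
-- The first two clauses are impossible: `q` is at least 2, and `l = 0` would force q (q - 1) = 0.
parameter-bounds {q = suc zero} (s≤s ()) _
parameter-bounds {v} {zero} {suc (suc _)} _ eq = contradiction (trans eq (ℕ.*-zeroʳ v)) λ ()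
parameter-bounds {v} {l@(suc l′)} {q@(suc q′@(suc _))} _ eq =
  _ , s≤s (ℕ.≤-trans q′+q≤a a≤v) , s≤s v≤
  where
  open ℕ.≤-Reasoning
  a = l + q′ + q

  expanded : l * a + q * q′ ≡ l * v
  expanded = begin-equality
    l * a + q * q′                ≡⟨ solve 3 (λ l p q → l :* (l :+ p :+ q) :+ q :* p := (l :+ q) :* (l :+ p)) refl l q′ q ⟩
    (l + q) * (l + q′)            ≡⟨ cong ((l + q) *_) (ℕ.+-suc l′ q′) ⟨
    (l + q) * (l + q ∸ 1)         ≡⟨ eq ⟩
    v * l                         ≡⟨ ℕ.*-comm v l ⟩
    l * v                         ∎

  a≤v : a ≤ v
  a≤v = ℕ.*-cancelˡ-≤ l (ℕ.≤-trans (ℕ.m≤m+n (l * a) (q * q′)) (ℕ.≤-reflexive expanded))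

  q′+q≤a : q′ + q ≤ a
  q′+q≤a = ℕ.+-monoˡ-≤ q (ℕ.m≤n+m q′ l)

  sum≤product+1 : ∀ m → l * m ≡ q * q′ → l + m ≤ 1 + l * m
  sum≤product+1 zero     l*m≡ = contradiction (trans (sym (ℕ.*-zeroʳ l)) l*m≡) λ ()
  sum≤product+1 (suc m′) _    = begin
    -- For positive factors this is (l - 1) (m - 1) ≥ 0.
    l + suc m′                   ≤⟨ ℕ.m≤m+n _ (l′ * m′) ⟩
    l + suc m′ + l′ * m′         ≡⟨ solve 2 (λ x y → con 1 :+ x :+ (con 1 :+ y) :+ x :* y := con 1 :+ (con 1 :+ x) :* (con 1 :+ y)) refl l′ m′ ⟩
    1 + l * suc m′               ∎

  μ = v ∸ a

  l*μ≡ : l * μ ≡ q * q′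
  l*μ≡ = ℕ.+-cancelˡ-≡ (l * a) _ _ (begin-equality
    l * a + l * μ     ≡⟨ ℕ.*-distribˡ-+ l a μ ⟨
    l * (a + μ)       ≡⟨ cong (l *_) (ℕ.m+[n∸m]≡n a≤v) ⟩
    l * v             ≡⟨ expanded ⟨
    l * a + q * q′    ∎)

  v≤ : v ≤ q + q * q
  v≤ = begin
    v                          ≡⟨ ℕ.m+[n∸m]≡n a≤v ⟨
    l + q′ + q + μ             ≡⟨ solve 4 (λ l p q m → l :+ p :+ q :+ m := l :+ m :+ (p :+ q)) refl l q′ q μ ⟩
    l + μ + (q′ + q)           ≤⟨ ℕ.+-monoˡ-≤ (q′ + q) (sum≤product+1 μ l*μ≡) ⟩
    1 + l * μ + (q′ + q)       ≡⟨ cong (λ z → 1 + z + (q′ + q)) l*μ≡ ⟩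
    1 + q * q′ + (q′ + q)      ≡⟨ solve 1 (λ p → con 1 :+ (con 1 :+ p) :* p :+ (p :+ (con 1 :+ p)) := (con 1 :+ p) :+ (con 1 :+ p) :* (con 1 :+ p)) refl q′ ⟩
    q + q * q                  ∎

-- Symmetric designs

module Design {v k l : ℕ} (D : SymmetricDesign (suc v) k l) (q≥2 : 2 ≤ k ∸ l) where
  open SymmetricDesign D

  q : ℕ
  q = k ∸ l

  incident : Fin (suc v) → Fin (suc v) → Bool
  incident B x = lookup (block B) x

  I : Fin (suc v) → Fin (suc v) → ℕ
  I B x = 𝟙 (incident B x)

  degree : Fin (suc v) → ℕ
  degree x = sum (λ B → I B x)

  -- A truncated difference of at least 2 is a true one, so `l < k`.
  l+q≡k : l + q ≡ k
  l+q≡k = ℕ.m+[n∸m]≡n {l} {k} (ℕ.<⇒≤ (ℕ.m∸n≢0⇒n<m {k} {l} (ℕ.>⇒≢ (ℕ.≤-trans (s≤s z≤n) q≥2))))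

  2≤k : 2 ≤ k
  2≤k = ℕ.≤-trans q≥2 (ℕ.m∸n≤m k l)

  instance
    k∸1≢0 : NonZero (k ∸ 1)
    k∸1≢0 = >-nonZero (ℕ.∸-monoˡ-≤ 1 2≤k)

  1+[k∸1]≡k : 1 + (k ∸ 1) ≡ k
  1+[k∸1]≡k = ℕ.m+[n∸m]≡n (ℕ.<⇒≤ 2≤k)

  -- Counting flags and separating blocks.

  sum-block : ∀ B → sum (I B) ≡ k
  sum-block B = trans (sym (∣p∣≡sum (block B))) (block-size B)

  ∣blocksThrough∣ : ∀ x → ∣ blocksThrough x ∣ ≡ degree x
  ∣blocksThrough∣ x = trans (∣p∣≡sum (blocksThrough x))
    (Σ.sum-cong-≗ (λ B → cong 𝟙 (lookup∘tabulate (λ C → incident C x) B)))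

  sum-join : ∀ {x y} → x ≢ y → sum (λ B → I B x * I B y) ≡ l
  sum-join {x} {y} x≢y = trans (sym (trans (∣p∣≡sum (blocksThrough x ∩ blocksThrough y)) (Σ.sum-cong-≗ term)))
    (points-join x≢y)
    where
    term : ∀ B → 𝟙 (lookup (blocksThrough x ∩ blocksThrough y) B) ≡ I B x * I B y
    term B = trans (cong 𝟙 (trans (lookup-zipWith _∧_ B (blocksThrough x) (blocksThrough y))
        (cong₂ _∧_ (lookup∘tabulate (λ C → incident C x) B) (lookup∘tabulate (λ C → incident C y) B))))
      (𝟙-∧ (incident B x) (incident B y))

  -- Count the flags (y , B) with x ∈ B, separating y = x from y ≠ x.
  degree-equation : ∀ x → degree x * (k ∸ 1) ≡ v * l
  degree-equation x = ℕ.+-cancelˡ-≡ (degree x) _ _ (begin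
    degree x + degree x * (k ∸ 1)                  ≡⟨ ℕ.*-suc (degree x) (k ∸ 1) ⟨
    degree x * (1 + (k ∸ 1))                       ≡⟨ cong (degree x *_) 1+[k∸1]≡k ⟩
    degree x * k                                   ≡⟨ Σ.*-distribʳ-sum k (λ B → I B x) ⟩
    sum (λ B → I B x * k)                          ≡⟨ Σ.sum-cong-≗ (λ B → trans (cong (I B x *_) (sym (sum-block B))) (Σ.*-distribˡ-sum (I B x) (I B))) ⟩
    sum (λ B → sum (λ y → I B x * I B y))          ≡⟨ Σ.∑-comm (λ B y → I B x * I B y) ⟩
    sum (λ y → sum (λ B → I B x * I B y))          ≡⟨ sum-const-off (λ y → sum (λ B → I B x * I B y)) x (λ y≢x → sum-join (y≢x ∘ sym)) ⟩
    sum (λ B → I B x * I B x) + v * l              ≡⟨ cong (_+ v * l) (Σ.sum-cong-≗ (λ B → 𝟙-idem (incident B x))) ⟩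
    degree x + v * l                               ∎)
    where open ≡-Reasoning

  -- Since `k ∸ 1` is nonzero, `degree-equation` makes all degrees equal. Counting all flags by
  -- points and by blocks then identifies the common value.
  degree≡k : ∀ x → degree x ≡ k
  degree≡k x = ℕ.*-cancelˡ-≡ (degree x) k (suc v) (begin
    suc v * degree x                   ≡⟨ sum-const (suc v) (degree x) ⟨
    sum {suc v} (λ _ → degree x)       ≡⟨ Σ.sum-cong-≗ (λ y → ℕ.*-cancelʳ-≡ (degree x) (degree y) (k ∸ 1) (trans (degree-equation x) (sym (degree-equation y)))) ⟩
    sum degree                         ≡⟨ Σ.∑-comm I ⟨
    sum (λ B → sum (I B))              ≡⟨ Σ.sum-cong-≗ sum-block ⟩
    sum {suc v} (λ _ → k)              ≡⟨ sum-const (suc v) k ⟩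
    suc v * k                          ∎)
    where open ≡-Reasoning

  bounds : NonZero l × q + q ≤ suc v × suc v ≤ 1 + q + q * q
  bounds = parameter-bounds q≥2 (subst (λ z → z * (z ∸ 1) ≡ v * l) (sym l+q≡k)
    (subst (λ z → z * (k ∸ 1) ≡ v * l) (degree≡k zero) (degree-equation zero)))

  separates : Fin (suc v) → Fin (suc v) → Fin (suc v) → Bool
  separates B x y = incident B x xor incident B y

  -- Each of the two points lies on `k` blocks and they share `l`, which leaves 2k - 2l = 2q.
  separating-count : ∀ {x y} → x ≢ y → sum (λ B → 𝟙 (separates B x y)) ≡ q + q
  separating-count {x} {y} x≢y = ℕ.+-cancelʳ-≡ (l + l) _ _ (begin
    s + (l + l)                                                ≡⟨ cong (λ z → s + (z + z)) (sum-join x≢y) ⟨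
    s + (sum both + sum both)                                  ≡⟨ cong (s +_) (Σ.∑-distrib-+ both both) ⟨
    s + sum (λ B → both B + both B)                            ≡⟨ Σ.∑-distrib-+ (λ B → 𝟙 (separates B x y)) (λ B → both B + both B) ⟨
    sum (λ B → 𝟙 (separates B x y) + (both B + both B))        ≡⟨ Σ.sum-cong-≗ (λ B → 𝟙-xor (incident B x) (incident B y)) ⟩
    sum (λ B → I B x + I B y)                                  ≡⟨ Σ.∑-distrib-+ (λ B → I B x) (λ B → I B y) ⟩
    degree x + degree y                                        ≡⟨ cong₂ _+_ (degree≡k x) (degree≡k y) ⟩
    k + k                                                      ≡⟨ cong (λ z → z + z) l+q≡k ⟨
    l + q + (l + q)                                            ≡⟨ solve 2 (λ l q → l :+ q :+ (l :+ q) := q :+ q :+ (l :+ l)) refl l q ⟩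
    q + q + (l + l)                                            ∎)
    where
    open ≡-Reasoning
    s = sum (λ B → 𝟙 (separates B x y))
    both : Fin (suc v) → ℕ
    both B = I B x * I B y

  -- Distances in the incidence graph.

  distance-1 : ∀ {x B} → x ∈ block B → IsDistance (Adjacent D) (point D x) (blockVertex D B) 1
  distance-1 x∈B = point-block x∈B ∷ [] , λ { (suc m) _ → s≤s z≤n }

  -- Some block `C` passes through `y` because `k > 0`. It differs from `B`, so the two meet in a
  -- point `z` because `l > 0`, and the walk runs y, C, z, B.
  distance-3 : ∀ {y B} → ¬ y ∈ block B → IsDistance (Adjacent D) (point D y) (blockVertex D B) 3
  distance-3 {y} {B} y∉B
    with C , C∈ ← 0<∣p∣⇒Nonempty (blocksThrough y)
           (subst (0 <_) (sym (trans (∣blocksThrough∣ y) (degree≡k y))) (ℕ.<⇒≤ 2≤k))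
    with y∈C ← lookup⇒[]= y (block C) (trans (sym (lookup∘tabulate (λ A → incident A y) C)) ([]=⇒lookup C∈))
    with z , z∈ ← 0<∣p∣⇒Nonempty (block C ∩ block B)
           (subst (0 <_) (sym (blocks-meet λ { refl → y∉B y∈C })) (ℕ.n≢0⇒n>0 (≢-nonZero⁻¹ l {{proj₁ bounds}})))
    with z∈C , z∈B ← x∈p∩q⁻ (block C) (block B) z∈
    = point-block y∈C ∷ block-point z∈C ∷ point-block z∈B ∷ [] , shortest
    where
    -- The graph is bipartite, so lengths 0 and 2 cannot end at a block, and length 1 would mean
    -- incidence.
    shortest : ∀ m → Walk (Adjacent D) m (point D y) (blockVertex D B) → 3 ≤ m
    shortest _ (point-block y∈B ∷ []) = contradiction y∈B y∉B
    shortest _ (point-block _ ∷ block-point _ ∷ point-block _ ∷ _) = s≤s (s≤s (s≤s z≤n))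

  ∉-block : ∀ {x B} → incident B x ≡ false → ¬ x ∈ block B
  ∉-block eq x∈B = contradiction (trans (sym ([]=⇒lookup x∈B)) eq) λ ()

  separates⇒Resolves : ∀ {B x y} → separates B x y ≡ true → Resolves D B x y
  separates⇒Resolves {B} {x} {y} sep with incident B x in x? | incident B y in y?
  ... | true  | false = 1 , 3 , distance-1 (lookup⇒[]= x (block B) x?) , distance-3 (∉-block y?) , λ ()
  ... | false | true  = 3 , 1 , distance-3 (∉-block x?) , distance-1 (lookup⇒[]= y (block B) y?) , λ ()
  ... | true  | true  = contradiction sep λ ()
  ... | false | false = contradiction sep λ ()

  semiResolving : ∀ n → n ≤ suc v → suc v * (suc v ∸ q) ^ n ≤ suc v ^ n →
    ∃ λ (S : Subset (suc v)) → ∣ S ∣ ≡ n × SemiResolvingForPoints D S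
  semiResolving n n≤v h = extend (cover-pairs {w = w} w+2q≡v zero separates
      (λ x≢y → ℕ.≤-reflexive (sym (separating-count x≢y)))
      (square-bound {w = w} {q} w+2q≡v n (subst (λ z → suc v * z ^ n ≤ suc v ^ n) (sym w+q≡v∸q) h)))
    where
    w = suc v ∸ (q + q)

    w+2q≡v : w + (q + q) ≡ suc v
    w+2q≡v = ℕ.m∸n+n≡m (proj₁ (proj₂ bounds))

    w+q≡v∸q : w + q ≡ suc v ∸ q
    w+q≡v∸q = trans (sym (ℕ.m+n∸n≡m (w + q) q)) (cong (_∸ q) (trans (ℕ.+-assoc w q q) w+2q≡v))

    extend : (∃ λ S → ∣ S ∣ ≤ n × (∀ {x y} → x ≢ y → ∃ λ B → B ∈ S × separates B x y ≡ true)) →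
      ∃ λ (S : Subset (suc v)) → ∣ S ∣ ≡ n × SemiResolvingForPoints D S
    -- Adding blocks keeps every pair separated, so `S` may be padded to size exactly `n`.
    extend (S , ∣S∣≤n , separated) with T , S⊆T , ∣T∣≡n ← superset-of-size S n ∣S∣≤n n≤v =
      T , ∣T∣≡n , λ x≢y →
        let B , B∈S , sep = separated x≢y in B , S⊆T B∈S , separates⇒Resolves sep

theorem2p5 : ∀ {v k l : ℕ} .{{_ : NonZero v}} (D : SymmetricDesign v k l) →
    (q≥2 : 2 ≤ k ∸ l) →
    ∀ n → IsCeiling n (_÷_ (v · log v) (k ∸ l) {{2≤⇒nonZero q≥2}}) →
    ∃ λ (S : Subset v) → ∣ S ∣ ≡ n × SemiResolvingForPoints D S
theorem2p5 {zero}  D q≥2 n _ = contradiction refl (≢-nonZero⁻¹ 0)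
theorem2p5 {suc v} D q≥2 n (n-1<x , x≤n) =
  -- The lower half of the ceiling condition gives `n ≤ suc v`; the upper half gives the power
  -- inequality that drives the greedy choice.
  semiResolving n (log-lower⇒ (suc v) q≥2 v≤1+q+q² n n-1<x)
    (log-upper⇒ (ℕ.m∸n+n≡m (ℕ.m+n≤o⇒m≤o q 2q≤v)) n x≤n)
  where
  open Design D q≥2
  2q≤v = proj₁ (proj₂ bounds)
  v≤1+q+q² = proj₂ (proj₂ bounds)
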